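{- Let $n \ge 2$ and let $C = (w_1, w_2, \dots, w_{2^n}, w_1)$ be a Hamiltonian cycle of the $n$-dimensional hypercube on vertex set $\{0,1\}^n$ (i.e. a cyclic Gray code: the $w_k$ are pairwise distinct, and consecutive words $w_k, w_{k+1}$, as well as $w_{2^n}, w_1$, differ in exactly one bit position). Let $f_C:\{0,1\}^n\to\{0,1\}^n$ be the Boolean map defined componentwise by $(f_C)_i(x) = x_i$ if the arc from $x$ to $x$ with bit $i$ flipped is one of the arcs $w_k\to w_{k+1}$ ($1\le k<2^n$) or $w_{2^n}\to w_1$ of $C$, and $(f_C)_i(x) = \overline{x_i}$ otherwise; thus $\Gamma(f_C)$ is the directed $n$-cube with the arcs of $C$ removed (and loops added). Then the iteration graph $\Gamma(f_C)$ is strongly connected.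
   Context: The directed $n$-cube has vertex set $\{0,1\}^n$ and an arc from $x$ to $y$ whenever $x$ and $y$ differ in exactly one bit (in both directions). For a Boolean map $f=(f_1,\dots,f_n):\{0,1\}^n\to\{0,1\}^n$, define $F_f(i,x) = (x_1,\dots,x_{i-1},f_i(x),x_{i+1},\dots,x_n)$ for $i\in\{1,\dots,n\}$. The iteration graph $\Gamma(f)$ is the directed graph with vertex set $\{0,1\}^n$ containing, for every $x$ and every $i$, an arc from $x$ to $F_f(i,x)$. A directed graph is strongly connected if every vertex can be reached from every other vertex by a directed path. -}

module Defs where

open import Data.Bool using (Bool; not; if_then_else_)
import Data.Bool.Properties as Bool
open import Data.Fin using (Fin; toℕ)
open import Data.Fin.Properties using (any?)
open import Data.Nat using (ℕ; suc; _^_; _≟_)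
open import Data.Product using (∃; ∃!; ∃₂; _×_)
open import Data.Sum using (_⊎_)
open import Data.Vec using (Vec; lookup; tabulate; _[_]≔_; _[_]%=_)
open import Data.Vec.Properties using (≡-dec)
open import Function.Definitions using (Injective)
open import Level using (Level)
open import Relation.Binary using (Rel; DecidableEquality; Decidable)
open import Relation.Binary.Construct.Closure.ReflexiveTransitive using (Star)
open import Relation.Binary.PropositionalEquality using (_≡_; _≢_)
open import Relation.Nullary using (does)
open import Relation.Nullary.Decidable using (_×-dec_; _⊎-dec_)

Word : ℕ → Set
Word n = Vec Bool n

_≟ʷ_ : ∀ {n} → DecidableEquality (Word n)
_≟ʷ_ = ≡-dec Bool._≟_

flip : ∀ {n} → Fin n → Word n → Word n
flip i x = x [ i ]%= not

CubeArc : ∀ {n} → Rel (Word n) _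
CubeArc x y = ∃! _≡_ λ i → lookup x i ≢ lookup y i

F : ∀ {n} → (Word n → Word n) → Fin n → Word n → Word n
F f i x = x [ i ]≔ lookup (f x) i

IterationGraph : ∀ {n} → (Word n → Word n) → Rel (Word n) _
IterationGraph f x y = ∃ λ i → y ≡ F f i x

StronglyConnected : ∀ {a ℓ : Level} {V : Set a} → Rel V ℓ → Set _
StronglyConnected _⟶_ = ∀ x y → Star _⟶_ x y

CyclicNext : ∀ {m} → Rel (Fin m) _
CyclicNext {m} k l = (toℕ l ≡ suc (toℕ k)) ⊎ (suc (toℕ k) ≡ m × toℕ l ≡ 0)

cyclicNext? : ∀ {m} → Decidable (CyclicNext {m})
cyclicNext? {m} k l = (toℕ l ≟ suc (toℕ k)) ⊎-dec ((suc (toℕ k) ≟ m) ×-dec (toℕ l ≟ 0))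

-- The words are indexed from 0: word k is w_{k+1}.  Being 2 ^ n distinct
-- words of length n, they exhaust the vertices of the cube.
record HamiltonianCycle (n : ℕ) : Set where
  field
    word     : Fin (2 ^ n) → Word n
    distinct : Injective _≡_ _≡_ word
    adjacent : ∀ k l → CyclicNext k l → CubeArc (word k) (word l)

module _ {n : ℕ} (C : HamiltonianCycle n) where
  open HamiltonianCycle C

  CycleArc : Rel (Word n) _
  CycleArc x y = ∃₂ λ k l → CyclicNext k l × word k ≡ x × word l ≡ y

  cycleArc? : Decidable CycleArc
  cycleArc? x y = any? λ k → any? λ l →
    cyclicNext? k l ×-dec ((word k ≟ʷ x) ×-dec (word l ≟ʷ y))

  cycleMap : Word n → Word n
  cycleMap x = tabulate λ i →
    if does (cycleArc? x (flip i x)) then lookup x i else not (lookup x i)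

{-# OPTIONS --safe #-}
-- The cycle C traversed backwards lies in Γ(f_C): as C has length 2ⁿ > 2, no arc
-- of C has its reverse in C.  By counting, C visits every vertex, so the backward
-- cycle connects any two vertices.
module Submission where

open import Defs
open import Data.Bool using (not; if_then_else_)
import Data.Bool.Properties as Bool
open import Data.Empty using (⊥-elim)
open import Data.Fin using (Fin; zero; suc; toℕ; fromℕ; inject₁; funToFin; finToFun)
open import Data.Fin.Induction using (<-weakInduction; >-weakInduction)
open import Data.Fin.Properties using (any?; toℕ-fromℕ; toℕ-inject₁; injective⇒≤; 2↔Bool; finToFun-funToFin)
import Data.Fin.Properties as Fin
open import Data.Nat using (ℕ; _≤_; _<_; _^_; suc; s<s; z<s)
open import Data.Nat.Properties using (1+n≰n; <-irrefl; <-trans; ≤-reflexive; ^-monoʳ-<)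
open import Data.Product using (∃; _,_)
open import Data.Sum using (inj₁; inj₂)
open import Data.Vec using (Vec; lookup)
open import Data.Vec.Properties using (tabulate∘lookup; lookup∘tabulate; tabulate-cong; lookup∘updateAt; lookup∘updateAt′; updateAt-cong-local)
open import Function using (_∘_; Inverse)
open import Function.Definitions using (Injective; StrictlySurjective)
open import Function.Properties.Inverse using (↔-sym; Inverse⇒Injection)
open import Function.Bundles using (Injection)
open import Relation.Binary using (Asymmetric; DecidableEquality)
open import Relation.Binary.Construct.Closure.ReflexiveTransitive using (Star; ε; _◅_; _◅◅_; gmap)
open import Relation.Binary.PropositionalEquality using (_≡_; _≗_; refl; sym; trans; cong; subst₂; module ≡-Reasoning)
open import Relation.Nullary using (¬_; yes; no; does)
open import Relation.Nullary.Decidable using (dec-false; decidable-stable)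

lookup-injective : ∀ {a} {A : Set a} {n} {xs ys : Vec A n} → lookup xs ≗ lookup ys → xs ≡ ys
lookup-injective {xs = xs} {ys} eq =
  trans (sym (tabulate∘lookup xs)) (trans (tabulate-cong eq) (tabulate∘lookup ys))

-- Pigeonhole: if `f` missed `x`, adding `x` to its values would give an injection of `suc m`
-- indices into `A`, and `g` would carry it into `Fin m`.
injective⇒strictlySurjective : ∀ {a} {A : Set a} {m} → DecidableEquality A →
  {g : A → Fin m} → Injective _≡_ _≡_ g →
  {f : Fin m → A} → Injective _≡_ _≡_ f → StrictlySurjective _≡_ f
injective⇒strictlySurjective {A = A} {m} _≟_ {g} g-inj {f} f-inj x with any? (λ k → f k ≟ x)
... | yes hit  = hit
... | no  miss = ⊥-elim (1+n≰n (injective⇒≤ {f = g ∘ extended} (extended-inj ∘ g-inj)))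
  where
  extended : Fin (suc m) → A
  extended zero    = x
  extended (suc k) = f k

  extended-inj : Injective _≡_ _≡_ extended
  extended-inj {zero}  {zero}  _  = refl
  extended-inj {zero}  {suc l} eq = ⊥-elim (miss (l , sym eq))
  extended-inj {suc k} {zero}  eq = ⊥-elim (miss (k , eq))
  extended-inj {suc k} {suc l} eq = cong suc (f-inj eq)

-- Bounds the number of words by `2 ^ n`, as the pigeonhole argument requires.
encode : ∀ {n} → Word n → Fin (2 ^ n)
encode x = funToFin (Inverse.from 2↔Bool ∘ lookup x)

encode-injective : ∀ {n} → Injective _≡_ _≡_ (encode {n})
encode-injective {n} {x} {y} eq = lookup-injective λ i →
  Injection.injective (Inverse⇒Injection (↔-sym 2↔Bool)) (begin
    Inverse.from 2↔Bool (lookup x i)  ≡⟨ finToFun-funToFin (Inverse.from 2↔Bool ∘ lookup x) i ⟨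
    finToFun (encode x) i             ≡⟨ cong (λ k → finToFun k i) eq ⟩
    finToFun (encode y) i             ≡⟨ finToFun-funToFin (Inverse.from 2↔Bool ∘ lookup y) i ⟩
    Inverse.from 2↔Bool (lookup y i)  ∎)
  where open ≡-Reasoning

cubeArc⇒flip : ∀ {n} {x y : Word n} → CubeArc x y → ∃ λ i → x ≡ flip i y
cubeArc⇒flip {n} {x} {y} (i , xᵢ≢yᵢ , unique) = i , lookup-injective agree
  where
  agree : lookup x ≗ lookup (flip i y)
  agree j with j Fin.≟ i
  ... | yes refl = trans (Bool.¬-not xᵢ≢yᵢ) (sym (lookup∘updateAt i y))
  ... | no  j≢i  = trans
    -- Uniqueness of `i` only refutes a difference at `j`; decidability of equality on bits turns
    -- this into agreement.
    (decidable-stable (lookup x j Bool.≟ lookup y j) (j≢i ∘ sym ∘ unique))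
    (sym (lookup∘updateAt′ j i j≢i y))

-- Two ordinary steps would give `k < l < k`, one step and one wrap-around force `m` to be 2, and
-- two wrap-arounds force it to be 1.
cyclicNext-asym : ∀ {m} → 2 < m → Asymmetric (CyclicNext {m})
cyclicNext-asym _   (inj₁ l≡1+k) (inj₁ k≡1+l) =
  <-irrefl refl (<-trans (≤-reflexive (sym l≡1+k)) (≤-reflexive (sym k≡1+l)))
cyclicNext-asym 2<m (inj₁ l≡1+k) (inj₂ (1+l≡m , k≡0)) =
  <-irrefl (trans (cong suc (sym (trans l≡1+k (cong suc k≡0)))) 1+l≡m) 2<m
cyclicNext-asym 2<m (inj₂ (1+k≡m , l≡0)) (inj₁ k≡1+l) =
  <-irrefl (trans (cong suc (sym (trans k≡1+l (cong suc l≡0)))) 1+k≡m) 2<m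
cyclicNext-asym 2<m (inj₂ (1+k≡m , l≡0)) (inj₂ (1+l≡m , k≡0)) =
  <-irrefl (trans (cong suc (sym k≡0)) 1+k≡m) (<-trans (s<s z<s) 2<m)

CyclicPrev : ∀ {m} → Fin m → Fin m → Set
CyclicPrev k l = CyclicNext l k

-- Descending from `k` to zero, wrapping to the last index and descending to `l` works whatever the
-- order of `k` and `l`.
cyclicPrev-stronglyConnected : ∀ {m} → StronglyConnected (CyclicPrev {m})
cyclicPrev-stronglyConnected {suc m} k l = toZero k ◅◅ wrap ◅ fromLast l
  where
  step : ∀ i → CyclicPrev (suc i) (inject₁ i)
  step i = inj₁ (cong suc (sym (toℕ-inject₁ i)))

  wrap : CyclicPrev zero (fromℕ m)
  wrap = inj₂ (cong suc (toℕ-fromℕ m) , refl)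

  toZero : ∀ i → Star CyclicPrev i zero
  toZero = <-weakInduction (λ i → Star CyclicPrev i zero) ε (λ i → step i ◅_)

  fromLast : ∀ i → Star CyclicPrev (fromℕ m) i
  fromLast = >-weakInduction (Star CyclicPrev (fromℕ m)) ε (λ i path → path ◅◅ step i ◅ ε)

module _ {n : ℕ} (C : HamiltonianCycle n) where
  open HamiltonianCycle C

  word-strictlySurjective : StrictlySurjective _≡_ word
  word-strictlySurjective = injective⇒strictlySurjective _≟ʷ_ encode-injective distinct

  cycleArc-asym : 1 < n → Asymmetric (CycleArc C)
  cycleArc-asym 1<n (k , l , k→l , refl , refl) (l′ , k′ , l′→k′ , l′≈l , k′≈k) =
    -- The bound `2 < 2 ^ n` is read as `2 ^ 1 < 2 ^ n`. Distinctness of the words then identifies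
    -- the indices of the two arcs.
    cyclicNext-asym (^-monoʳ-< 2 (s<s z<s) 1<n) k→l
      (subst₂ CyclicNext (distinct l′≈l) (distinct k′≈k) l′→k′)

  ¬cycleArc⇒F≡flip : ∀ i x → ¬ CycleArc C x (flip i x) → F (cycleMap C) i x ≡ flip i x
  -- Both sides are updates of `x` at `i`, one by a constant and one by `not`, so comparing the new
  -- bits suffices.
  ¬cycleArc⇒F≡flip i x ¬arc = updateAt-cong-local i x (begin
    lookup (cycleMap C x) i
      ≡⟨ lookup∘tabulate _ i ⟩
    (if does (cycleArc? C x (flip i x)) then lookup x i else not (lookup x i))
      ≡⟨ cong (if_then lookup x i else not (lookup x i)) (dec-false (cycleArc? C x (flip i x)) ¬arc) ⟩
    not (lookup x i) ∎)
    where open ≡-Reasoning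

  -- The cycle runs from `word l` to `word k` along some bit `i`. By asymmetry it does not contain
  -- the way back, so `cycleMap C` negates bit `i` of `word k`.
  reversedArc : 1 < n → ∀ {k l} → CyclicPrev k l → IterationGraph (cycleMap C) (word k) (word l)
  reversedArc 1<n {k} {l} l→k with i , l≡flip ← cubeArc⇒flip (adjacent l k l→k) =
    i , trans l≡flip (sym (¬cycleArc⇒F≡flip i (word k)
      (cycleArc-asym 1<n (l , k , l→k , l≡flip , refl))))

theorem2 : (n : ℕ) → 2 ≤ n → (C : HamiltonianCycle n) → StronglyConnected (IterationGraph (cycleMap C))
theorem2 n 2≤n C x y
  with k , refl ← word-strictlySurjective C x
     | l , refl ← word-strictlySurjective C y
  -- `word` maps the backward cycle of indices homomorphically into the iteration graph; `2 ≤ n` is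
  -- `1 < n` by definition.
  = gmap (HamiltonianCycle.word C) (reversedArc C 2≤n) (cyclicPrev-stronglyConnected k l)
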